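{- Let $T$ be a strong monad on $\mathbf{Met}$ and let $E$ be a finite set. Then the tensor $T\otimes(-)^{\underline{E}}$ of $T$ with the reader monad $(-)^{\underline{E}}$ exists and is given by the monad composition $(T-)^{\underline{E}}$.
   Context: $\mathbf{Met}$ is the category of extended metric spaces (metrics valued in $[0,\infty]$, with $d(x,y)=0$ iff $x=y$) and non-expansive maps. It is symmetric monoidal closed: $X\square Y$ is $X\times Y$ with $d((x,y),(x',y'))=d_X(x,x')+d_Y(y,y')$, the unit is the one-point space, and the internal hom $Y^X=[X,Y]$ is the set of non-expansive maps with metric $\sup_{x}d_Y(f(x),g(x))$. Strong functors, strong natural transformations and strong monads are taken with respect to $\square$; a strength $t_{X,Y}:X\square FY\to F(X\square Y)$ is necessarily $t(x,u)=F(y\mapsto(x,y))(u)$. Reader monad. $\underline{E}$ is $E$ with the discrete metric (distance $\infty$ between distinct points); $X^{\underline{E}}$ is the set of all maps $E\to X$ with sup metric; unit $\kappa_X(x)(e)=x$, multiplication $\zeta_X(g)(e)=g(e)(e)$. Composite monad. The strength of $T=(T,\eta,\mu)$ gives a distributive law $\lambda_X:T(X^{\underline{E}})\to(TX)^{\underline{E}}$, $\lambda_X(u)(e)=T(\mathrm{ev}_e)(u)$, of $T$ over $(-)^{\underline{E}}$. The monad composition $(T-)^{\underline{E}}$ sends $X$ to $(TX)^{\underline{E}}$, has unit $x\mapsto(e\mapsto\eta_X(x))$ and multiplication sending $g\in(T((TX)^{\underline{E}}))^{\underline{E}}$ to $e\mapsto\mu_X(T(\mathrm{ev}_e)(g(e)))$.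 Tensor of strong monads. For $v\in\mathbf{Met}$, $(-)^v$ is a strong functor. For a strong endofunctor $F$ and an $F$-algebra $(A,a:FA\to A)$, its $v$-power is $(A,a)^v=(A^v,\bar a)$ with $\bar a(u)(p)=a(F(\mathrm{ev}_p)(u))$ for $u\in F(A^v)$, $p\in v$, where $\mathrm{ev}_p:A^v\to A$ is evaluation at $p$. A $v$-ary pre-operation of $F$ is a strong natural transformation $g:(-)^v\Rightarrow F$; set $a^g=a\circ g_A:A^v\to A$. For strong monads $T,T'$ on $\mathbf{Met}$, an Eilenberg–Moore tensor $\langle T,T'\rangle$-algebra is a triple $(A,a,b)$ with $(A,a)$ an Eilenberg–Moore $T$-algebra and $(A,b)$ an Eilenberg–Moore $T'$-algebra such that for all $v\in\mathbf{Met}$ and all $v$-ary pre-operations $g$ of $T$, $a^g$ is a $T'$-homomorphism $(A,b)^v\to(A,b)$ (this is equivalent to the condition with the roles of $T$ and $T'$ exchanged). Morphisms are non-expansive maps that are both $T$- and $T'$-homomorphisms. If the forgetful functor from this category to $\mathbf{Met}$ has a left adjoint, the monad induced by the adjunction is the tensor $T\otimes T'$ (determined up to isomorphism of monads). -}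

module Defs where

open import Level using (Level; suc; _⊔_; Lift; lift; lower)
open import Algebra.Bundles using (CommutativeMonoid)
import Algebra.Properties.CommutativeSemigroup as CommutativeSemigroupProperties
open import Data.Empty using (⊥; ⊥-elim)
open import Data.Product using (Σ-syntax; _×_; _,_; proj₁; proj₂)
open import Data.Rational as ℚ using (ℚ; 0ℚ; 1ℚ)
import Data.Rational.Properties as ℚ
open import Data.Product.Relation.Binary.Pointwise.NonDependent using (×-setoid)
open import Data.Unit.Polymorphic using (⊤; tt)
open import Function.Bundles using (_⇔_; mk⇔; Equivalence)
open import Relation.Binary.Bundles using (Setoid)
open import Relation.Binary.Structures using (IsEquivalence)
open import Relation.Binary.PropositionalEquality as ≡ using (_≡_; refl)
open import Relation.Nullary using (¬_)

private
  lower-bound : ∀ p → (∀ q → p ℚ.< q → 0ℚ ℚ.≤ q) → 0ℚ ℚ.≤ p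
  lower-bound p h = ℚ.≮⇒≥ contra
    where
      contra : ¬ (p ℚ.< 0ℚ)
      contra p<0 with ℚ.<-dense {p} {0ℚ} p<0
      ... | r , p<r , r<0 = ℚ.<-irrefl {r} refl (ℚ.<-≤-trans r<0 (h r p<r))

  p<p+1 : ∀ p → p ℚ.< p ℚ.+ 1ℚ
  p<p+1 p = ≡.subst (ℚ._< p ℚ.+ 1ℚ) (ℚ.+-identityʳ p)
    (ℚ.+-monoʳ-< p (ℚ.positive⁻¹ 1ℚ))

  p≤p+r : ∀ {p r} → 0ℚ ℚ.≤ r → p ℚ.≤ p ℚ.+ r
  p≤p+r {p} {r} 0≤r = ≡.subst (ℚ._≤ p ℚ.+ r) (ℚ.+-identityʳ p) (ℚ.+-monoʳ-≤ p 0≤r)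

  cancel-minus : ∀ p r → (p ℚ.+ r) ℚ.+ ℚ.- r ≡ p
  cancel-minus p r = ≡.trans (ℚ.+-assoc p r (ℚ.- r))
    (≡.trans (≡.cong (p ℚ.+_) (ℚ.+-inverseʳ r)) (ℚ.+-identityʳ p))

  minus-cancel : ∀ p r → (p ℚ.+ ℚ.- r) ℚ.+ r ≡ p
  minus-cancel p r = ≡.trans (ℚ.+-assoc p (ℚ.- r) r)
    (≡.trans (≡.cong (p ℚ.+_) (ℚ.+-inverseˡ r)) (ℚ.+-identityʳ p))

  interchange : ∀ a b c e → (a ℚ.+ b) ℚ.+ (c ℚ.+ e) ≡ (a ℚ.+ c) ℚ.+ (b ℚ.+ e)
  interchange = CommutativeSemigroupProperties.interchange
    (CommutativeMonoid.commutativeSemigroup ℚ.+-0-commutativeMonoid)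

-- The extended half-line [0,∞].
--
-- A number a is presented by the set of rationals q with a ≤ q, that is, by a
-- closed up-set of non-negative rationals (∞ is the empty one).  Classically
-- every such set is [a,∞) ∩ ℚ for a unique a ∈ [0,∞]; constructively this
-- presentation is the one that has arbitrary suprema.

record ℝ∞ (ℓ : Level) : Set (suc ℓ) where
  no-eta-equality
  field
    upper  : ℚ → Set ℓ
    nonNeg : ∀ {q} → upper q → 0ℚ ℚ.≤ q
    upward : ∀ {p q} → p ℚ.≤ q → upper p → upper q
    closed : ∀ {p} → (∀ q → p ℚ.< q → upper q) → upper p

open ℝ∞ public

infix 4 _≤_ _≈∞_
infixl 6 _+_

record _≤_ {ℓ} (a b : ℝ∞ ℓ) : Set ℓ where
  constructor mk≤
  field bound : ∀ {q} → upper b q → upper a q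

open _≤_ public

_≈∞_ : ∀ {ℓ} → ℝ∞ ℓ → ℝ∞ ℓ → Set ℓ
a ≈∞ b = a ≤ b × b ≤ a

0∞ : ∀ {ℓ} → ℝ∞ ℓ
upper  (0∞ {ℓ}) q         = Lift ℓ (0ℚ ℚ.≤ q)
nonNeg 0∞ u               = lower u
upward 0∞ p≤q u           = lift (ℚ.≤-trans (lower u) p≤q)
closed 0∞ {p} h           = lift (lower-bound p λ q p<q → lower (h q p<q))

∞ : ∀ {ℓ} → ℝ∞ ℓ
upper  (∞ {ℓ}) _ = Lift ℓ ⊥
nonNeg ∞ u       = ⊥-elim (lower u)
upward ∞ _ u     = u
closed ∞ {p} h   = h (p ℚ.+ 1ℚ) (p<p+1 p)

-- a + b ≤ q iff every δ > q splits as a sum of upper bounds of a and of b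
-- (up to ≤); quantifying over δ keeps the sum closed.
_+_ : ∀ {ℓ} → ℝ∞ ℓ → ℝ∞ ℓ → ℝ∞ ℓ
upper (a + b) q = ∀ δ → q ℚ.< δ →
  Σ[ p ∈ ℚ ] Σ[ r ∈ ℚ ] (p ℚ.+ r ℚ.≤ δ × upper a p × upper b r)
nonNeg (a + b) {q} h = lower-bound q λ δ q<δ →
  let (p , r , p+r≤δ , u , v) = h δ q<δ in
  ℚ.≤-trans (ℚ.+-mono-≤ (nonNeg a u) (nonNeg b v)) p+r≤δ
upward (a + b) p≤q h δ q<δ = h δ (ℚ.≤-<-trans p≤q q<δ)
closed (a + b) h δ p<δ =
  let (q , p<q , q<δ) = ℚ.<-dense p<δ in h q p<q δ q<δ

⨆ : ∀ {ℓ} {I : Set ℓ} → (I → ℝ∞ ℓ) → ℝ∞ ℓ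
upper  (⨆ f) q             = 0ℚ ℚ.≤ q × (∀ i → upper (f i) q)
nonNeg (⨆ f)               = proj₁
upward (⨆ f) p≤q (0≤p , h) = ℚ.≤-trans 0≤p p≤q , λ i → upward (f i) p≤q (h i)
closed (⨆ f) {p} h         = lower-bound p (λ q p<q → proj₁ (h q p<q))
                           , λ i → closed (f i) λ q p<q → proj₂ (h q p<q) i

-- Only the existence of these proofs matters; making them abstract keeps normal
-- forms small.
module _ {ℓ : Level} where abstract

  ≤-refl : {a : ℝ∞ ℓ} → a ≤ a
  ≤-refl = mk≤ λ u → u

  ≤-trans : {a b c : ℝ∞ ℓ} → a ≤ b → b ≤ c → a ≤ c
  ≤-trans f g = mk≤ λ u → bound f (bound g u)

  0≤ : {a : ℝ∞ ℓ} → 0∞ ≤ a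
  0≤ {a} = mk≤ λ u → lift (nonNeg a u)

  ≤0⇒≈0 : {a : ℝ∞ ℓ} → a ≤ 0∞ → a ≈∞ 0∞
  ≤0⇒≈0 a≤0 = a≤0 , 0≤

  ≤⨆ : {I : Set ℓ} (f : I → ℝ∞ ℓ) (i : I) → f i ≤ ⨆ f
  ≤⨆ f i = mk≤ λ u → proj₂ u i

  ⨆-least : {I : Set ℓ} {f : I → ℝ∞ ℓ} {a : ℝ∞ ℓ} → (∀ i → f i ≤ a) → ⨆ f ≤ a
  ⨆-least {a = a} h = mk≤ λ u → nonNeg a u , λ i → bound (h i) u

  +-upper : (a b : ℝ∞ ℓ) {p r : ℚ} → upper a p → upper b r → upper (a + b) (p ℚ.+ r)
  +-upper a b {p} {r} u v δ <δ = p , r , ℚ.<⇒≤ <δ , u , v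

  +-elim : (a b : ℝ∞ ℓ) (P : ℚ → Set ℓ) →
           (∀ {p q} → p ℚ.≤ q → P p → P q) →
           (∀ {p} → (∀ q → p ℚ.< q → P q) → P p) →
           (∀ {p r} → upper a p → upper b r → P (p ℚ.+ r)) →
           ∀ {q} → upper (a + b) q → P q
  +-elim a b P up cl f h = cl λ δ q<δ →
    let (p , r , p+r≤δ , u , v) = h δ q<δ in up p+r≤δ (f u v)

  ≤+ : (a b c : ℝ∞ ℓ) →
       (∀ {p r} → upper b p → upper c r → upper a (p ℚ.+ r)) → a ≤ b + c
  ≤+ a b c f = mk≤ (+-elim b c (upper a) (upward a) (closed a) f)

  +-mono : {a a′ b b′ : ℝ∞ ℓ} → a ≤ a′ → b ≤ b′ → a + b ≤ a′ + b′
  +-mono {a} {a′} {b} {b′} f g = ≤+ (a + b) a′ b′ λ u v →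
    +-upper a b (bound f u) (bound g v)

  +-comm : (a b : ℝ∞ ℓ) → a + b ≤ b + a
  +-comm a b = ≤+ (a + b) b a λ {p} {r} u v →
    ≡.subst (upper (a + b)) (ℚ.+-comm r p) (+-upper a b v u)

  a≤a+b : (a b : ℝ∞ ℓ) → a ≤ a + b
  a≤a+b a b = ≤+ a a b λ u v → upward a (p≤p+r (nonNeg b v)) u

  b≤a+b : (a b : ℝ∞ ℓ) → b ≤ a + b
  b≤a+b a b = ≤-trans (a≤a+b b a) (+-comm b a)

  +-identityʳ : (a : ℝ∞ ℓ) → a + 0∞ ≤ a
  +-identityʳ a = mk≤ λ {q} u →
    ≡.subst (upper (a + 0∞)) (ℚ.+-identityʳ q) (+-upper a 0∞ u (lift ℚ.≤-refl))

  +-identityˡ : (a : ℝ∞ ℓ) → 0∞ + a ≤ a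
  +-identityˡ a = ≤-trans (+-comm 0∞ a) (+-identityʳ a)

  -- {p | p + r is an upper bound of a} is a closed up-set.
  shift-up : (a : ℝ∞ ℓ) (r : ℚ) → ∀ {p q} → p ℚ.≤ q →
             upper a (p ℚ.+ r) → upper a (q ℚ.+ r)
  shift-up a r p≤q = upward a (ℚ.+-monoˡ-≤ r p≤q)

  shift-cl : (a : ℝ∞ ℓ) (r : ℚ) → ∀ {p} →
             (∀ q → p ℚ.< q → upper a (q ℚ.+ r)) → upper a (p ℚ.+ r)
  shift-cl a r {p} h = closed a λ q p+r<q →
      ≡.subst (upper a) (minus-cancel q r)
        (h (q ℚ.+ ℚ.- r)
           (≡.subst (ℚ._< q ℚ.+ ℚ.- r) (cancel-minus p r) (ℚ.+-monoˡ-< (ℚ.- r) p+r<q)))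

  +-assoc : (a b c : ℝ∞ ℓ) → a + (b + c) ≤ (a + b) + c
  +-assoc a b c = ≤+ x (a + b) c λ {_} {r} u w →
    +-elim a b (λ q → upper x (q ℚ.+ r)) (shift-up x r) (shift-cl x r)
      (λ {p} {s} u v → ≡.subst (upper x) (≡.sym (ℚ.+-assoc p s r))
        (+-upper a (b + c) u (+-upper b c v w)))
      u
    where
      x : ℝ∞ ℓ
      x = a + (b + c)

  +-interchange : (a b c e : ℝ∞ ℓ) → (a + c) + (b + e) ≤ (a + b) + (c + e)
  +-interchange a b c e = ≤+ x (a + b) (c + e) λ {p} {r} u w →
    +-elim a b (λ q → upper x (q ℚ.+ r)) (shift-up x r) (shift-cl x r)
      (λ {p₁} {p₂} u v →
        ≡.subst (upper x) (ℚ.+-comm r (p₁ ℚ.+ p₂))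
          (+-elim c e (λ q → upper x (q ℚ.+ (p₁ ℚ.+ p₂)))
            (shift-up x (p₁ ℚ.+ p₂)) (shift-cl x (p₁ ℚ.+ p₂))
            (λ {r₁} {r₂} w z →
              ≡.subst (upper x)
                (≡.trans (interchange p₁ r₁ p₂ r₂) (ℚ.+-comm (p₁ ℚ.+ p₂) (r₁ ℚ.+ r₂)))
                (+-upper (a + c) (b + e) (+-upper a c u w) (+-upper b e v z)))
            w))
      u
    where
      x : ℝ∞ ℓ
      x = (a + c) + (b + e)

record Category (o h e : Level) : Set (suc (o ⊔ h ⊔ e)) where
  no-eta-equality
  infix  4 _≈_
  infixr 9 _∘_
  field
    Obj       : Set o
    Hom       : Obj → Obj → Set h
    _≈_       : ∀ {A B} → Hom A B → Hom A B → Set e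
    id        : ∀ {A} → Hom A A
    _∘_       : ∀ {A B C} → Hom B C → Hom A B → Hom A C
    equiv     : ∀ {A B} → IsEquivalence (_≈_ {A} {B})
    ∘-cong    : ∀ {A B C} {f g : Hom B C} {h k : Hom A B} →
                f ≈ g → h ≈ k → f ∘ h ≈ g ∘ k
    identityˡ : ∀ {A B} {f : Hom A B} → id ∘ f ≈ f
    identityʳ : ∀ {A B} {f : Hom A B} → f ∘ id ≈ f
    assoc     : ∀ {A B C D} {f : Hom C D} {g : Hom B C} {h : Hom A B} →
                (f ∘ g) ∘ h ≈ f ∘ (g ∘ h)

  homSetoid : (A B : Obj) → Setoid h e
  homSetoid A B = record { isEquivalence = equiv {A} {B} }

  module ≈ {A B} = IsEquivalence (equiv {A} {B})

record Functor {o h e o′ h′ e′} (C : Category o h e) (D : Category o′ h′ e′) :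
               Set (o ⊔ h ⊔ e ⊔ o′ ⊔ h′ ⊔ e′) where
  no-eta-equality
  private
    module C = Category C
    module D = Category D
  field
    F₀           : C.Obj → D.Obj
    F₁           : ∀ {A B} → C.Hom A B → D.Hom (F₀ A) (F₀ B)
    F-cong       : ∀ {A B} {f g : C.Hom A B} → f C.≈ g → F₁ f D.≈ F₁ g
    identity     : ∀ {A} → F₁ (C.id {A}) D.≈ D.id
    homomorphism : ∀ {A B E} {f : C.Hom B E} {g : C.Hom A B} →
                   F₁ (f C.∘ g) D.≈ F₁ f D.∘ F₁ g

module _ {o h e} {C : Category o h e} where

  Id : Functor C C
  Id = record
    { F₀ = λ A → A ; F₁ = λ f → f ; F-cong = λ p → p
    ; identity = ≈.refl ; homomorphism = ≈.refl }
    where open Category C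

infixr 9 _∘F_

_∘F_ : ∀ {o h e o′ h′ e′ o″ h″ e″}
       {C : Category o h e} {D : Category o′ h′ e′} {E : Category o″ h″ e″} →
       Functor D E → Functor C D → Functor C E
_∘F_ {E = E} G F = record
  { F₀ = λ A → G.F₀ (F.F₀ A)
  ; F₁ = λ f → G.F₁ (F.F₁ f)
  ; F-cong = λ p → G.F-cong (F.F-cong p)
  ; identity = E.≈.trans (G.F-cong F.identity) G.identity
  ; homomorphism = E.≈.trans (G.F-cong F.homomorphism) G.homomorphism
  }
  where
    module F = Functor F
    module G = Functor G
    module E = Category E

record NatTrans {o h e o′ h′ e′} {C : Category o h e} {D : Category o′ h′ e′}
                (F G : Functor C D) : Set (o ⊔ h ⊔ e ⊔ o′ ⊔ h′ ⊔ e′) where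
  no-eta-equality
  private
    module C = Category C
    module D = Category D
    module F = Functor F
    module G = Functor G
  field
    component : ∀ A → D.Hom (F.F₀ A) (G.F₀ A)
    natural   : ∀ {A B} (f : C.Hom A B) →
                component B D.∘ F.F₁ f D.≈ G.F₁ f D.∘ component A

record Monad {o h e} (C : Category o h e) : Set (o ⊔ h ⊔ e) where
  no-eta-equality
  open Category C
  field
    functor : Functor C C
    unit    : NatTrans Id functor
    mult    : NatTrans (functor ∘F functor) functor
  open Functor functor public
  η : ∀ A → Hom A (F₀ A)
  η = NatTrans.component unit
  μ : ∀ A → Hom (F₀ (F₀ A)) (F₀ A)
  μ = NatTrans.component mult
  field
    μ-assoc     : ∀ A → μ A ∘ F₁ (μ A) ≈ μ A ∘ μ (F₀ A)
    μ-identityˡ : ∀ A → μ A ∘ F₁ (η A) ≈ id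
    μ-identityʳ : ∀ A → μ A ∘ η (F₀ A) ≈ id

record MonadIso {o h e} {C : Category o h e} (M N : Monad C) : Set (o ⊔ h ⊔ e) where
  no-eta-equality
  open Category C
  private
    module M = Monad M
    module N = Monad N
  field
    forward : NatTrans M.functor N.functor
  open NatTrans forward public renaming (component to φ)
  field
    φ⁻¹       : ∀ A → Hom (N.F₀ A) (M.F₀ A)
    inverseˡ  : ∀ A → φ⁻¹ A ∘ φ A ≈ id
    inverseʳ  : ∀ A → φ A ∘ φ⁻¹ A ≈ id
    unit-law  : ∀ A → φ A ∘ M.η A ≈ N.η A
    mult-law  : ∀ A → φ A ∘ M.μ A ≈ N.μ A ∘ N.F₁ (φ A) ∘ φ (M.F₀ A)

record Adjunction {o h e o′ h′ e′} {C : Category o h e} {D : Category o′ h′ e′}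
                  (L : Functor C D) (R : Functor D C) :
                  Set (o ⊔ h ⊔ e ⊔ o′ ⊔ h′ ⊔ e′) where
  no-eta-equality
  private
    module C = Category C
    module D = Category D
    module L = Functor L
    module R = Functor R
  field
    unit   : NatTrans Id (R ∘F L)
    counit : NatTrans (L ∘F R) Id
  η : ∀ A → C.Hom A (R.F₀ (L.F₀ A))
  η = NatTrans.component unit
  ε : ∀ B → D.Hom (L.F₀ (R.F₀ B)) B
  ε = NatTrans.component counit
  field
    zig : ∀ A → ε (L.F₀ A) D.∘ L.F₁ (η A) D.≈ D.id
    zag : ∀ B → R.F₁ (ε B) C.∘ η (R.F₀ B) C.≈ C.id

record HasLeftAdjoint {o h e o′ h′ e′} {C : Category o h e} {D : Category o′ h′ e′}
                      (R : Functor D C) : Set (o ⊔ h ⊔ e ⊔ o′ ⊔ h′ ⊔ e′) where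
  no-eta-equality
  field
    L          : Functor C D
    adjunction : Adjunction L R

inducedMonad : ∀ {o h e o′ h′ e′} {C : Category o h e} {D : Category o′ h′ e′}
               {L : Functor C D} {R : Functor D C} → Adjunction L R → Monad C
inducedMonad {C = C} {D} {L} {R} adj = record
  { functor = R ∘F L
  ; unit = unit
  ; mult = record
    { component = λ A → R.F₁ (ε (L.F₀ A))
    ; natural = λ f → push (NatTrans.natural counit (L.F₁ f))
    }
  ; μ-assoc = λ A → push (NatTrans.natural counit (ε (L.F₀ A)))
  ; μ-identityˡ = λ A → C.≈.trans (C.≈.sym R.homomorphism)
      (C.≈.trans (R.F-cong (zig A)) R.identity)
  ; μ-identityʳ = λ A → zag (L.F₀ A)
  }
  where
    module C = Category C
    module D = Category D
    module L = Functor L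
    module R = Functor R
    open Adjunction adj
    push : ∀ {A B B′ E} {f : D.Hom B E} {g : D.Hom A B} {f′ : D.Hom B′ E} {g′ : D.Hom A B′} →
           f D.∘ g D.≈ f′ D.∘ g′ → R.F₁ f C.∘ R.F₁ g C.≈ R.F₁ f′ C.∘ R.F₁ g′
    push p = C.≈.trans (C.≈.sym R.homomorphism) (C.≈.trans (R.F-cong p) R.homomorphism)

record MetricSpace (ℓ : Level) : Set (suc ℓ) where
  no-eta-equality
  field
    setoid : Setoid ℓ ℓ
  open Setoid setoid public hiding (refl; sym; trans)
  open Setoid setoid public using () renaming (refl to ≈-refl; sym to ≈-sym; trans to ≈-trans)
  field
    d          : Carrier → Carrier → ℝ∞ ℓ
    d≈0⇔≈      : ∀ {x y} → d x y ≈∞ 0∞ ⇔ x ≈ y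
    d-sym      : ∀ x y → d x y ≤ d y x
    d-triangle : ∀ x y z → d x z ≤ d x y + d y z

  abstract
    d≤0⇒≈ : ∀ {x y} → d x y ≤ 0∞ → x ≈ y
    d≤0⇒≈ h = Equivalence.to d≈0⇔≈ (≤0⇒≈0 h)

    ≈⇒d≤0 : ∀ {x y} → x ≈ y → d x y ≤ 0∞
    ≈⇒d≤0 p = proj₁ (Equivalence.from d≈0⇔≈ p)

    d-cong-≤ : ∀ {x x′ y y′} → x ≈ x′ → y ≈ y′ → d x y ≤ d x′ y′
    d-cong-≤ {x} {x′} {y} {y′} p q =
      ≤-trans (d-triangle x x′ y)
     (≤-trans (+-mono (≈⇒d≤0 p) (d-triangle x′ y′ y))
     (≤-trans (+-identityˡ _)
     (≤-trans (+-mono ≤-refl (≈⇒d≤0 (≈-sym q)))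
              (+-identityʳ _))))

open MetricSpace public using
  (Carrier; setoid; d; d≈0⇔≈; d-sym; d-triangle; d≤0⇒≈; ≈⇒d≤0; d-cong-≤; ≈-refl; ≈-sym; ≈-trans)

infix 4 _⟶_

record _⟶_ {ℓ} (X Y : MetricSpace ℓ) : Set ℓ where
  private
    module X = MetricSpace X
    module Y = MetricSpace Y
  field
    to           : X.Carrier → Y.Carrier
    nonExpansive : ∀ x x′ → Y.d (to x) (to x′) ≤ X.d x x′

  abstract
    cong : ∀ {x x′} → x X.≈ x′ → to x Y.≈ to x′
    cong p = Y.d≤0⇒≈ (≤-trans (nonExpansive _ _) (X.≈⇒d≤0 p))

open _⟶_ public using (to; nonExpansive; cong)

Met : (ℓ : Level) → Category (suc ℓ) ℓ ℓ
Category.Obj (Met ℓ) = MetricSpace ℓ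
Category.Hom (Met ℓ) = _⟶_
Category._≈_ (Met ℓ) {X} {Y} f g = ∀ x → MetricSpace._≈_ Y (to f x) (to g x)
to           (Category.id (Met ℓ)) x     = x
nonExpansive (Category.id (Met ℓ)) _ _   = ≤-refl
to           (Category._∘_ (Met ℓ) f g) x = to f (to g x)
nonExpansive (Category._∘_ (Met ℓ) f g) x x′ =
  ≤-trans (nonExpansive f _ _) (nonExpansive g x x′)
Category.equiv (Met ℓ) {X} {Y} = record
  { refl  = λ _ → ≈-refl Y
  ; sym   = λ p x → ≈-sym Y (p x)
  ; trans = λ p q x → ≈-trans Y (p x) (q x)
  }
Category.∘-cong (Met ℓ) {C = Z} {f = f} p q x = ≈-trans Z (cong f (q x)) (p _)
Category.identityˡ (Met ℓ) {B = Y} _ = ≈-refl Y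
Category.identityʳ (Met ℓ) {B = Y} _ = ≈-refl Y
Category.assoc (Met ℓ) {D = W} _ = ≈-refl W

infixr 8 _□_

_□_ : ∀ {ℓ} → MetricSpace ℓ → MetricSpace ℓ → MetricSpace ℓ
setoid (X □ Y) = ×-setoid (setoid X) (setoid Y)
d (X □ Y) (x , y) (x′ , y′) = d X x x′ + d Y y y′
d≈0⇔≈ (X □ Y) {x , y} {x′ , y′} = mk⇔
  (λ (h , _) → d≤0⇒≈ X (≤-trans (a≤a+b (d X x x′) (d Y y y′)) h)
             , d≤0⇒≈ Y (≤-trans (b≤a+b (d X x x′) (d Y y y′)) h))
  (λ (p , q) → ≤0⇒≈0 (≤-trans (+-mono (≈⇒d≤0 X p) (≈⇒d≤0 Y q)) (+-identityʳ 0∞)))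
d-sym (X □ Y) (x , y) (x′ , y′) = +-mono (d-sym X x x′) (d-sym Y y y′)
d-triangle (X □ Y) (x , y) (x′ , y′) (x″ , y″) =
  ≤-trans (+-mono (d-triangle X x x′ x″) (d-triangle Y y y′ y″))
          (+-interchange (d X x x′) (d Y y y′) (d X x′ x″) (d Y y′ y″))

𝟙 : ∀ {ℓ} → MetricSpace ℓ
setoid 𝟙 = ≡.setoid ⊤
d 𝟙 _ _ = 0∞
d≈0⇔≈ 𝟙 = mk⇔ (λ _ → refl) (λ _ → ≤-refl , ≤-refl)
d-sym 𝟙 _ _ = ≤-refl
d-triangle 𝟙 _ _ _ = 0≤

d-at : ∀ {ℓ} {X Y : MetricSpace ℓ} (f g : X ⟶ Y) (x : Carrier X) →
       d Y (to f x) (to g x) ≤ ⨆ (λ x → d Y (to f x) (to g x))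
d-at {Y = Y} f g x = ≤⨆ (λ x → d Y (to f x) (to g x)) x

infixr 7 _⇨_

_⇨_ : ∀ {ℓ} → MetricSpace ℓ → MetricSpace ℓ → MetricSpace ℓ
setoid (_⇨_ {ℓ} X Y) = Category.homSetoid (Met ℓ) X Y
d (X ⇨ Y) f g = ⨆ λ x → d Y (to f x) (to g x)
d≈0⇔≈ (X ⇨ Y) {f} {g} = mk⇔
  (λ (h , _) x → d≤0⇒≈ Y (≤-trans (d-at f g x) h))
  (λ p → ≤0⇒≈0 (⨆-least λ x → ≈⇒d≤0 Y (p x)))
d-sym (X ⇨ Y) f g = ⨆-least λ x →
  ≤-trans (d-sym Y (to f x) (to g x)) (d-at g f x)
d-triangle (X ⇨ Y) f g k = ⨆-least λ x →
  ≤-trans (d-triangle Y (to f x) (to g x) (to k x)) (+-mono (d-at f g x) (d-at g k x))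

module _ {ℓ : Level} where
  open Category (Met ℓ)

  infixr 8 _□₁_

  _□₁_ : {X X′ Y Y′ : MetricSpace ℓ} → X ⟶ X′ → Y ⟶ Y′ → X □ Y ⟶ X′ □ Y′
  f □₁ g = record
    { to = λ (x , y) → to f x , to g y
    ; nonExpansive = λ _ _ → +-mono (nonExpansive f _ _) (nonExpansive g _ _)
    }

  unitor : (Y : MetricSpace ℓ) → 𝟙 □ Y ⟶ Y
  unitor Y = record { to = proj₂ ; nonExpansive = λ _ _ → b≤a+b _ _ }

  associator : (X Y Z : MetricSpace ℓ) → (X □ Y) □ Z ⟶ X □ (Y □ Z)
  associator X Y Z = record
    { to = λ ((x , y) , z) → x , (y , z)
    ; nonExpansive = λ _ _ → +-assoc _ _ _
    }

  pair : {X : MetricSpace ℓ} (Y : MetricSpace ℓ) → Carrier X → Y ⟶ X □ Y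
  pair {X} Y x = record
    { to = λ y → x , y
    ; nonExpansive = λ _ _ →
        ≤-trans (+-mono (≈⇒d≤0 X (≈-refl X)) ≤-refl) (+-identityˡ _)
    }

  ev : (V A : MetricSpace ℓ) → Carrier V → V ⇨ A ⟶ A
  ev V A p = record { to = λ h → to h p ; nonExpansive = λ f g → ≤⨆ _ p }

  eval : (V A : MetricSpace ℓ) → V □ (V ⇨ A) ⟶ A
  eval V A = record
    { to = λ (p , h) → to h p
    ; nonExpansive = λ (p , h) (p′ , h′) →
        ≤-trans (d-triangle A (to h p) (to h p′) (to h′ p′))
          (+-mono (nonExpansive h p p′) (≤⨆ _ p′))
    }

record Strength {ℓ} (F : Functor (Met ℓ) (Met ℓ)) : Set (suc ℓ) where
  no-eta-equality
  open Functor F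
  open Category (Met ℓ)
  field
    strength : ∀ X Y → X □ F₀ Y ⟶ F₀ (X □ Y)
    strength-natural : ∀ {X X′ Y Y′} (f : X ⟶ X′) (g : Y ⟶ Y′) →
      strength X′ Y′ ∘ (f □₁ F₁ g) ≈ F₁ (f □₁ g) ∘ strength X Y
    strength-unit : ∀ Y → F₁ (unitor Y) ∘ strength 𝟙 Y ≈ unitor (F₀ Y)
    strength-assoc : ∀ X Y Z →
      F₁ (associator X Y Z) ∘ strength (X □ Y) Z ≈
      strength X (Y □ Z) ∘ (id □₁ strength Y Z) ∘ associator X Y (F₀ Z)

  abstract
    strength-pair : ∀ X Y (x : Carrier X) u →
      MetricSpace._≈_ (F₀ (X □ Y)) (to (strength X Y) (x , u)) (to (F₁ (pair Y x)) u)
    strength-pair X Y x u = begin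
      to (strength X Y) (x , u)                                ≈⟨ cong (strength X Y) (≈-refl X , ≈-sym (F₀ Y) (identity u)) ⟩
      to (strength X Y) (x , to (F₁ id) u)                     ≈⟨ strength-natural point id (tt , u) ⟩
      to (F₁ (point □₁ id)) (to (strength 𝟙 Y) (tt , u))       ≈⟨ F-cong (λ _ → ≈-refl (X □ Y)) (to (strength 𝟙 Y) (tt , u)) ⟩
      to (F₁ (pair Y x ∘ unitor Y)) (to (strength 𝟙 Y) (tt , u)) ≈⟨ homomorphism (to (strength 𝟙 Y) (tt , u)) ⟩
      to (F₁ (pair Y x)) (to (F₁ (unitor Y)) (to (strength 𝟙 Y) (tt , u))) ≈⟨ cong (F₁ (pair Y x)) (strength-unit Y (tt , u)) ⟩
      to (F₁ (pair Y x)) u ∎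
      where
        open import Relation.Binary.Reasoning.Setoid (setoid (F₀ (X □ Y)))
        point : 𝟙 ⟶ X
        point = record { to = λ _ → x ; nonExpansive = λ _ _ → ≈⇒d≤0 X (≈-refl X) }

record StrongNatTrans {ℓ} {F G : Functor (Met ℓ) (Met ℓ)}
                      (S : Strength F) (R : Strength G) : Set (suc ℓ) where
  no-eta-equality
  open Category (Met ℓ)
  private
    module F = Functor F
    module G = Functor G
    module S = Strength S
    module R = Strength R
  field
    natTrans : NatTrans F G
  open NatTrans natTrans public
  field
    strong : ∀ X Y → component (X □ Y) ∘ S.strength X Y ≈ R.strength X Y ∘ (id □₁ component Y)

record StrongMonad (ℓ : Level) : Set (suc ℓ) where
  no-eta-equality
  open Category (Met ℓ)
  field
    monad : Monad (Met ℓ)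
  open Monad monad public
  field
    isStrong : Strength functor
  open Strength isStrong public
  field
    η-strong : ∀ X Y → strength X Y ∘ (id □₁ η Y) ≈ η (X □ Y)
    μ-strong : ∀ X Y → strength X Y ∘ (id □₁ μ Y) ≈
                       μ (X □ Y) ∘ F₁ (strength X Y) ∘ strength X (F₀ Y)

module _ {ℓ : Level} (V : MetricSpace ℓ) where
  open Category (Met ℓ)

  Power : Functor (Met ℓ) (Met ℓ)
  Power = record
    { F₀ = λ X → V ⇨ X
    ; F₁ = λ f → record
        { to = λ h → f ∘ h
        ; nonExpansive = λ h h′ → ⨆-least λ p → ≤-trans (nonExpansive f _ _) (≤⨆ _ p) }
    ; F-cong = λ p h x → p (to h x)
    ; identity = λ {X} _ _ → ≈-refl X
    ; homomorphism = λ {_} {_} {Z} _ _ → ≈-refl Z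
    }

  PowerStrength : Strength Power
  PowerStrength = record
    { strength = λ X Y → record
        { to = λ (x , h) → pair Y x ∘ h
        ; nonExpansive = λ (x , h) (x′ , h′) → ⨆-least λ p → +-mono ≤-refl (≤⨆ _ p) }
    ; strength-natural = λ {_} {X′} {_} {Y′} _ _ _ _ → ≈-refl (X′ □ Y′)
    ; strength-unit = λ Y _ _ → ≈-refl Y
    ; strength-assoc = λ X Y Z _ _ → ≈-refl (X □ (Y □ Z))
    }

  module _ {F : Functor (Met ℓ) (Met ℓ)} (S : Strength F) where
    open Functor F
    open Strength S

    abstract
      ev-nonExpansive : ∀ A (u : Carrier (F₀ (V ⇨ A))) p q →
        d (F₀ A) (to (F₁ (ev V A p)) u) (to (F₁ (ev V A q)) u) ≤ d V p q
      ev-nonExpansive A u p q =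
        ≤-trans (d-cong-≤ (F₀ A) (via-eval p) (via-eval q))
       (≤-trans (nonExpansive (F₁ (eval V A)) _ _)
       (≤-trans (nonExpansive (strength V (V ⇨ A)) _ _)
       (≤-trans (+-mono ≤-refl (≈⇒d≤0 (F₀ (V ⇨ A)) (≈-refl (F₀ (V ⇨ A))))) (+-identityʳ _))))
        where
          via-eval : ∀ p → MetricSpace._≈_ (F₀ A) (to (F₁ (ev V A p)) u)
                             (to (F₁ (eval V A)) (to (strength V (V ⇨ A)) (p , u)))
          via-eval p = ≈-trans (F₀ A)
            (F-cong {f = ev V A p} {g = eval V A ∘ pair (V ⇨ A) p} (λ _ → ≈-refl A) u)
            (≈-trans (F₀ A) (homomorphism u)
              (≈-sym (F₀ A) (cong (F₁ (eval V A)) (strength-pair V (V ⇨ A) p u))))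

    -- u ↦ (p ↦ F(ev_p)(u)).  For V discrete on E this is the distributive law
    -- of F over the reader monad.
    dist : ∀ A → F₀ (V ⇨ A) ⟶ V ⇨ F₀ A
    to (to (dist A) u) p             = to (F₁ (ev V A p)) u
    nonExpansive (to (dist A) u) p q = ev-nonExpansive A u p q
    nonExpansive (dist A) u u′       = ⨆-least λ p → nonExpansive (F₁ (ev V A p)) u u′

    powerAlgebra : ∀ {A} → F₀ A ⟶ A → F₀ (V ⇨ A) ⟶ V ⇨ A
    powerAlgebra {A} a = Functor.F₁ Power a ∘ dist A

module _ {ℓ : Level} where
  open Category (Met ℓ)

  -- Only the underlying functor matters here, since powers are formed for algebras
  -- of a strong functor.
  IsHomomorphism : (F : Functor (Met ℓ) (Met ℓ)) {A B : MetricSpace ℓ} →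
                   Functor.F₀ F A ⟶ A → Functor.F₀ F B ⟶ B → A ⟶ B → Set ℓ
  IsHomomorphism F a b f = f ∘ a ≈ b ∘ Functor.F₁ F f

  record IsEMAlgebra (T : Monad (Met ℓ)) (A : MetricSpace ℓ) (a : Monad.F₀ T A ⟶ A) : Set ℓ where
    private module T = Monad T
    field
      unit-law : a ∘ T.η A ≈ id
      mult-law : a ∘ T.μ A ≈ a ∘ T.F₁ a

  PreOperation : (V : MetricSpace ℓ) {F : Functor (Met ℓ) (Met ℓ)} → Strength F → Set (suc ℓ)
  PreOperation V S = StrongNatTrans (PowerStrength V) S

  module _ (T T′ : StrongMonad ℓ) where
    private
      module T = StrongMonad T
      module T′ = StrongMonad T′

    record TensorAlgebra : Set (suc ℓ) where
      no-eta-equality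
      field
        A : MetricSpace ℓ
        a : T.F₀ A ⟶ A
        b : T′.F₀ A ⟶ A
        a-isEM : IsEMAlgebra T.monad A a
        b-isEM : IsEMAlgebra T′.monad A b
        commute : ∀ V (g : PreOperation V T.isStrong) →
          IsHomomorphism T′.functor (powerAlgebra V T′.isStrong b) b
            (a ∘ StrongNatTrans.component g A)

    record TensorHom (X Y : TensorAlgebra) : Set ℓ where
      private
        module X = TensorAlgebra X
        module Y = TensorAlgebra Y
      field
        map   : X.A ⟶ Y.A
        a-hom : IsHomomorphism T.functor X.a Y.a map
        b-hom : IsHomomorphism T′.functor X.b Y.b map

    private
      id-hom : (F : Functor (Met ℓ) (Met ℓ)) {A : MetricSpace ℓ} (a : Functor.F₀ F A ⟶ A) →
               IsHomomorphism F a a id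
      id-hom F {A} a u = cong a (≈-sym (Functor.F₀ F A) (Functor.identity F u))

      ∘-hom : (F : Functor (Met ℓ) (Met ℓ)) {A B C : MetricSpace ℓ}
              (a : Functor.F₀ F A ⟶ A) (b : Functor.F₀ F B ⟶ B) (c : Functor.F₀ F C ⟶ C)
              (f : B ⟶ C) (g : A ⟶ B) →
              IsHomomorphism F b c f → IsHomomorphism F a b g → IsHomomorphism F a c (f ∘ g)
      ∘-hom F {C = C} a b c f g p q u = C.≈-trans (cong f (q u))
        (C.≈-trans (p (to (Functor.F₁ F g) u))
          (cong c (≈-sym (Functor.F₀ F C) (Functor.homomorphism F u))))
        where module C = MetricSpace C

    TensorAlgebras : Category (suc ℓ) ℓ ℓ
    TensorAlgebras = record
      { Obj = TensorAlgebra
      ; Hom = TensorHom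
      ; _≈_ = λ f g → TensorHom.map f ≈ TensorHom.map g
      ; id = λ {X} → record
          { map = id
          ; a-hom = id-hom T.functor (TensorAlgebra.a X)
          ; b-hom = id-hom T′.functor (TensorAlgebra.b X) }
      ; _∘_ = λ {X} {Y} {Z} f g →
          let module X = TensorAlgebra X
              module Y = TensorAlgebra Y
              module Z = TensorAlgebra Z
              module f = TensorHom f
              module g = TensorHom g
          in record
          { map = f.map ∘ g.map
          ; a-hom = ∘-hom T.functor X.a Y.a Z.a f.map g.map f.a-hom g.a-hom
          ; b-hom = ∘-hom T′.functor X.b Y.b Z.b f.map g.map f.b-hom g.b-hom }
      ; equiv = λ {X} {Y} → let module Y = MetricSpace (TensorAlgebra.A Y) in record
          { refl = λ _ → Y.≈-refl
          ; sym = λ p x → Y.≈-sym (p x)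
          ; trans = λ p q x → Y.≈-trans (p x) (q x) }
      ; ∘-cong = λ {_} {_} {Z} {f} p q x →
          ≈-trans (TensorAlgebra.A Z) (cong (TensorHom.map f) (q x)) (p _)
      ; identityˡ = λ {_} {Y} _ → ≈-refl (TensorAlgebra.A Y)
      ; identityʳ = λ {_} {Y} _ → ≈-refl (TensorAlgebra.A Y)
      ; assoc = λ {_} {_} {_} {W} _ → ≈-refl (TensorAlgebra.A W)
      }

    Forget : Functor TensorAlgebras (Met ℓ)
    Forget = record
      { F₀ = TensorAlgebra.A
      ; F₁ = TensorHom.map
      ; F-cong = λ p → p
      ; identity = λ {X} _ → ≈-refl (TensorAlgebra.A X)
      ; homomorphism = λ {_} {_} {Z} _ → ≈-refl (TensorAlgebra.A Z)
      }

    record IsTensor (M : Monad (Met ℓ)) : Set (suc ℓ) where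
      no-eta-equality
      field
        hasLeftAdjoint : HasLeftAdjoint Forget
        iso : MonadIso (inducedMonad (HasLeftAdjoint.adjunction hasLeftAdjoint)) M

-- d(e,e′) is 0 when e ≡ e′ and ∞ otherwise: {q ≥ 0 | e ≡ e′} is the cut of 0 in
-- the first case and is empty in the second.
discrete-d : ∀ {ℓ} {E : Set ℓ} → E → E → ℝ∞ ℓ
upper  (discrete-d e e′) q             = 0ℚ ℚ.≤ q × e ≡ e′
nonNeg (discrete-d e e′)               = proj₁
upward (discrete-d e e′) p≤q (0≤p , p) = ℚ.≤-trans 0≤p p≤q , p
closed (discrete-d e e′) {p} h         = lower-bound p (λ q p<q → proj₁ (h q p<q))
                                       , proj₂ (h (p ℚ.+ 1ℚ) (p<p+1 p))

discrete : ∀ {ℓ} → Set ℓ → MetricSpace ℓ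
setoid (discrete E) = ≡.setoid E
d (discrete E) = discrete-d
d≈0⇔≈ (discrete E) = mk⇔ (λ (h , _) → proj₂ (bound h (lift ℚ.≤-refl)))
                          (λ p → ≤0⇒≈0 (mk≤ λ u → lower u , p))
d-sym (discrete E) _ _ = mk≤ λ (0≤q , p) → 0≤q , ≡.sym p
d-triangle (discrete E) x y z =
  ≤+ (discrete-d x z) (discrete-d x y) (discrete-d y z) λ (0≤p , p) (0≤q , q) →
    ℚ.+-mono-≤ 0≤p 0≤q , ≡.trans p q

discrete-∞ : ∀ {ℓ} (E : Set ℓ) {e e′ : E} → ¬ e ≡ e′ → d (discrete E) e e′ ≈∞ ∞
discrete-∞ E e≢e′ = mk≤ (λ u → ⊥-elim (lower u)) , mk≤ (λ u → lift (e≢e′ (proj₂ u)))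

module _ {ℓ : Level} (E : Set ℓ) where
  open Category (Met ℓ)

  fromDiscrete : (X : MetricSpace ℓ) → (E → Carrier X) → discrete E ⟶ X
  fromDiscrete X f = record
    { to = f
    ; nonExpansive = λ { e e′ → mk≤ λ { (0≤q , refl) →
        bound (≈⇒d≤0 X (≈-refl X)) (lift 0≤q) } }
    }

  κ : ∀ X → X ⟶ discrete E ⇨ X
  κ X = record
    { to = λ x → fromDiscrete X λ e → x
    ; nonExpansive = λ _ _ → ⨆-least λ _ → ≤-refl
    }

  ζ : ∀ X → discrete E ⇨ (discrete E ⇨ X) ⟶ discrete E ⇨ X
  ζ X = record
    { to = λ g → fromDiscrete X λ e → to (to g e) e
    ; nonExpansive = λ g g′ → ⨆-least λ e → ≤-trans (≤⨆ _ e) (≤⨆ _ e)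
    }

  Reader : StrongMonad ℓ
  Reader = record
    { monad = record
      { functor = Power (discrete E)
      ; unit = record { component = κ ; natural = λ {_} {Y} _ _ _ → ≈-refl Y }
      ; mult = record { component = ζ ; natural = λ {_} {Y} _ _ _ → ≈-refl Y }
      ; μ-assoc = λ X _ _ → ≈-refl X
      ; μ-identityˡ = λ X _ _ → ≈-refl X
      ; μ-identityʳ = λ X _ _ → ≈-refl X
      }
    ; isStrong = PowerStrength (discrete E)
    ; η-strong = λ X Y _ _ → ≈-refl (X □ Y)
    ; μ-strong = λ X Y _ _ → ≈-refl (X □ Y)
    }

  module _ (T : StrongMonad ℓ) where
    private module T = StrongMonad T

    -- Unfolds to g ↦ (e ↦ μ (T(ev_e) (g e))).
    compositeMult : ∀ X → discrete E ⇨ T.F₀ (discrete E ⇨ T.F₀ X) ⟶ discrete E ⇨ T.F₀ X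
    compositeMult X = Functor.F₁ (Power (discrete E)) (T.μ X) ∘ ζ (T.F₀ (T.F₀ X))
                      ∘ Functor.F₁ (Power (discrete E)) (dist (discrete E) T.isStrong (T.F₀ X))

    private
      D = discrete E

      -- T(f) ∘ T(g) = T(h) whenever f ∘ g = h
      fuse : ∀ {X Y Z} (f : Y ⟶ Z) (g : X ⟶ Y) (h : X ⟶ Z) → f ∘ g ≈ h →
             T.F₁ f ∘ T.F₁ g ≈ T.F₁ h
      fuse {Z = Z} f g h p u = FZ.≈-trans (FZ.≈-sym (T.homomorphism u)) (T.F-cong p u)
        where module FZ = MetricSpace (T.F₀ Z)

      P₁ : ∀ {X Y} → X ⟶ Y → D ⇨ X ⟶ D ⇨ Y
      P₁ = Functor.F₁ (Power D)

      mult-natural : ∀ {X Y} (f : X ⟶ Y) →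
        compositeMult Y ∘ P₁ (T.F₁ (P₁ (T.F₁ f))) ≈ P₁ (T.F₁ f) ∘ compositeMult X
      mult-natural {X} {Y} f g e = begin
        to (T.μ Y) (to (T.F₁ (ev D (T.F₀ Y) e)) (to (T.F₁ (P₁ (T.F₁ f))) (to g e)))
          ≈⟨ cong (T.μ Y) (fuse (ev D (T.F₀ Y) e) (P₁ (T.F₁ f)) (T.F₁ f ∘ ev D (T.F₀ X) e)
               (λ _ → ≈-refl (T.F₀ Y)) (to g e)) ⟩
        to (T.μ Y) (to (T.F₁ (T.F₁ f ∘ ev D (T.F₀ X) e)) (to g e))
          ≈⟨ cong (T.μ Y) (T.homomorphism (to g e)) ⟩
        to (T.μ Y) (to (T.F₁ (T.F₁ f)) (to (T.F₁ (ev D (T.F₀ X) e)) (to g e)))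
          ≈⟨ NatTrans.natural T.mult f _ ⟩
        to (T.F₁ f) (to (T.μ X) (to (T.F₁ (ev D (T.F₀ X) e)) (to g e))) ∎
        where open import Relation.Binary.Reasoning.Setoid (setoid (T.F₀ Y))

      mult-assoc : ∀ X →
        compositeMult X ∘ P₁ (T.F₁ (compositeMult X)) ≈ compositeMult X ∘ compositeMult (D ⇨ T.F₀ X)
      mult-assoc X g e = begin
        to (T.μ X) (to (T.F₁ (evX e)) (to (T.F₁ (compositeMult X)) (to g e)))
          ≈⟨ cong (T.μ X) (fuse (evX e) (compositeMult X) (T.μ X ∘ T.F₁ (evX e) ∘ evTX e)
               (λ _ → ≈-refl (T.F₀ X)) (to g e)) ⟩
        to (T.μ X) (to (T.F₁ (T.μ X ∘ T.F₁ (evX e) ∘ evTX e)) (to g e))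
          ≈⟨ cong (T.μ X) (T.homomorphism (to g e)) ⟩
        to (T.μ X) (to (T.F₁ (T.μ X)) (to (T.F₁ (T.F₁ (evX e) ∘ evTX e)) (to g e)))
          ≈⟨ T.μ-assoc X _ ⟩
        to (T.μ X) (to (T.μ (T.F₀ X)) (to (T.F₁ (T.F₁ (evX e) ∘ evTX e)) (to g e)))
          ≈⟨ cong (T.μ X) (cong (T.μ (T.F₀ X)) (T.homomorphism (to g e))) ⟩
        to (T.μ X) (to (T.μ (T.F₀ X)) (to (T.F₁ (T.F₁ (evX e))) (to (T.F₁ (evTX e)) (to g e))))
          ≈⟨ cong (T.μ X) (NatTrans.natural T.mult (evX e) _) ⟩
        to (T.μ X) (to (T.F₁ (evX e)) (to (T.μ (D ⇨ T.F₀ X)) (to (T.F₁ (evTX e)) (to g e)))) ∎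
        where
          open import Relation.Binary.Reasoning.Setoid (setoid (T.F₀ X))
          evX : E → D ⇨ T.F₀ X ⟶ T.F₀ X
          evX = ev D (T.F₀ X)
          evTX : E → D ⇨ T.F₀ (D ⇨ T.F₀ X) ⟶ T.F₀ (D ⇨ T.F₀ X)
          evTX = ev D (T.F₀ (D ⇨ T.F₀ X))

    compositeUnit : ∀ X → X ⟶ discrete E ⇨ T.F₀ X
    compositeUnit X = κ (T.F₀ X) ∘ T.η X

    Composite : Monad (Met ℓ)
    Composite = record
      { functor = Power (discrete E) ∘F T.functor
      ; unit = record
        { component = compositeUnit
        ; natural = λ f x e → NatTrans.natural T.unit f x }
      ; mult = record { component = compositeMult ; natural = mult-natural }
      ; μ-assoc = mult-assoc
      ; μ-identityˡ = λ X g e → ≈-trans (T.F₀ X)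
          (cong (T.μ X) (fuse (ev D (T.F₀ X) e) (compositeUnit X) (T.η X)
            (λ _ → ≈-refl (T.F₀ X)) (to g e)))
          (T.μ-identityˡ X (to g e))
      ; μ-identityʳ = λ X g e → ≈-trans (T.F₀ X)
          (cong (T.μ X) (≈-sym (T.F₀ (T.F₀ X))
            (NatTrans.natural T.unit (ev D (T.F₀ X) e) g)))
          (T.μ-identityʳ X (to g e))
      }

{-# OPTIONS --safe #-}
-- The free tensor algebra on X is (TX)^E, with T acting pointwise and the reader
-- monad acting by ζ; the counit at (A,a,b) sends φ : E → TA to b(e ↦ a(φ e)).
-- That it preserves the T-structure amounts to b being a T-homomorphism
-- (A,a)^E → (A,a).  Every u ∈ T(A^E) is a pre-operation of arity A^E by Yoneda,
-- and the compatibility of that operation with b, evaluated at the family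
-- e ↦ ev_e of elements of A^(A^E), is the homomorphism equation at u.
module Submission where

open import Defs
open import Data.Nat using (ℕ)
open import Data.Fin using (Fin)
open import Data.Product using (_,_)
open import Function.Bundles using (_↔_)

module _ {ℓ} {F : Functor (Met ℓ) (Met ℓ)} (S : Strength F) where
  open Category (Met ℓ)
  open Functor F
  open Strength S

  abstract
    -- The strength turns `F₁ h` at `u` into `F₁ apply` at `strength (h , u)`, where the map `h` is
    -- itself a point of `V ⇨ Y`; both outer maps are non-expansive and `u` stays fixed.
    F₁-nonExpansive : ∀ {V Y} (u : Carrier (F₀ V)) (h k : V ⟶ Y) →
      d (F₀ Y) (to (F₁ h) u) (to (F₁ k) u) ≤ d (V ⇨ Y) h k
    F₁-nonExpansive {V} {Y} u h k =
      ≤-trans (d-cong-≤ (F₀ Y) (via-eval h) (via-eval k))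
     (≤-trans (nonExpansive (F₁ apply) _ _)
     (≤-trans (nonExpansive (strength (V ⇨ Y) V) _ _)
     (≤-trans (+-mono ≤-refl (≈⇒d≤0 (F₀ V) (≈-refl (F₀ V)))) (+-identityʳ _))))
      where
        apply : (V ⇨ Y) □ V ⟶ Y
        apply = record
          { to = λ (h , p) → to h p
          ; nonExpansive = λ (h , p) (h′ , p′) →
              ≤-trans (d-triangle Y (to h p) (to h′ p) (to h′ p′))
                (+-mono (≤⨆ _ p) (nonExpansive h′ p p′)) }
        via-eval : ∀ h → MetricSpace._≈_ (F₀ Y) (to (F₁ h) u)
                           (to (F₁ apply) (to (strength (V ⇨ Y) V) (h , u)))
        via-eval h = ≈-trans (F₀ Y)
          (F-cong {f = h} {g = apply ∘ pair V h} (λ _ → ≈-refl Y) u)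
          (≈-trans (F₀ Y) (homomorphism u)
            (≈-sym (F₀ Y) (cong (F₁ apply) (strength-pair (V ⇨ Y) V h u))))

  -- The transformation whose value at `id` is `u`. It is strong because by `strength-pair` both
  -- sides are `F₁ (pair Y x ∘ h)` at `u`.
  yoneda : ∀ {V} → Carrier (F₀ V) → PreOperation V S
  yoneda {V} u = record
    { natTrans = record
      { component = λ Y → record
        { to = λ h → to (F₁ h) u ; nonExpansive = F₁-nonExpansive u }
      ; natural = λ f h → homomorphism u }
    ; strong = λ X Y (x , h) → ≈-trans (F₀ (X □ Y)) (homomorphism u)
        (≈-sym (F₀ (X □ Y)) (strength-pair X Y x (to (F₁ h) u))) }

module _ {ℓ} (T : StrongMonad ℓ) (E : Set ℓ) where
  open Category (Met ℓ)
  private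
    module T = StrongMonad T
    module C = Monad (Composite E T)
    D = discrete E

    P₁ : ∀ {X Y} → X ⟶ Y → D ⇨ X ⟶ D ⇨ Y
    P₁ = Functor.F₁ (Power D)

    lift-T : ∀ {A} → T.F₀ A ⟶ A → T.F₀ (D ⇨ A) ⟶ D ⇨ A
    lift-T = powerAlgebra D T.isStrong

    -- Both laws can be checked at each `e`, where `ev D A e` is a `T`-homomorphism to `(A, a)` by
    -- construction.
    lift-T-isEM : ∀ {A} (a : T.F₀ A ⟶ A) → IsEMAlgebra T.monad A a →
                  IsEMAlgebra T.monad (D ⇨ A) (lift-T a)
    lift-T-isEM {A} a isEM = record
      { unit-law = λ h e → ≈-trans A
          (cong a (≈-sym (T.F₀ A) (NatTrans.natural T.unit (ev D A e) h)))
          (unit-law (to h e))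
      ; mult-law = λ w e → begin
          to a (to (T.F₁ (ev D A e)) (to (T.μ (D ⇨ A)) w))
            ≈⟨ cong a (NatTrans.natural T.mult (ev D A e) w) ⟨
          to a (to (T.μ A) (to (T.F₁ (T.F₁ (ev D A e))) w))
            ≈⟨ mult-law _ ⟩
          to a (to (T.F₁ a) (to (T.F₁ (T.F₁ (ev D A e))) w))
            ≈⟨ cong a (T.homomorphism w) ⟨
          to a (to (T.F₁ (a ∘ T.F₁ (ev D A e))) w)
            -- The two maps have the same underlying function but different proofs of
            -- non-expansiveness.
            ≈⟨ cong a (T.F-cong (λ _ → ≈-refl A) w) ⟩
          to a (to (T.F₁ (ev D A e ∘ lift-T a)) w)
            ≈⟨ cong a (T.homomorphism w) ⟩
          to a (to (T.F₁ (ev D A e)) (to (T.F₁ (lift-T a)) w)) ∎ }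
      where
        open IsEMAlgebra isEM
        open import Relation.Binary.Reasoning.Setoid (setoid A)

    lift-T-hom : ∀ {A B} (a : T.F₀ A ⟶ A) (b : T.F₀ B ⟶ B) (f : A ⟶ B) →
      IsHomomorphism T.functor a b f →
      IsHomomorphism T.functor (lift-T a) (lift-T b) (P₁ f)
    lift-T-hom {A} {B} a b f hom u e = begin
      to f (to a (to (T.F₁ (ev D A e)) u))
        ≈⟨ hom _ ⟩
      to b (to (T.F₁ f) (to (T.F₁ (ev D A e)) u))
        ≈⟨ cong b (T.homomorphism u) ⟨
      to b (to (T.F₁ (f ∘ ev D A e)) u)
        ≈⟨ cong b (T.F-cong (λ _ → ≈-refl B) u) ⟩
      to b (to (T.F₁ (ev D B e ∘ P₁ f)) u)
        ≈⟨ cong b (T.homomorphism u) ⟩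
      to b (to (T.F₁ (ev D B e)) (to (T.F₁ (P₁ f)) u)) ∎
      where open import Relation.Binary.Reasoning.Setoid (setoid B)

    free : MetricSpace ℓ → TensorAlgebra T (Reader E)
    free X = record
      { A = D ⇨ T.F₀ X
      ; a = lift-T (T.μ X)
      ; b = ζ E (T.F₀ X)
      ; a-isEM = lift-T-isEM (T.μ X) record { unit-law = T.μ-identityʳ X
                                    ; mult-law = λ w → ≈-sym (T.F₀ X) (T.μ-assoc X w) }
      ; b-isEM = record { unit-law = λ _ _ → ≈-refl (T.F₀ X)
                        ; mult-law = λ _ _ → ≈-refl (T.F₀ X) }
      -- Naturality of `g` along evaluation at `e` brings both sides to `T.μ X` of `g` at the map
      -- sending `p` to `k` evaluated at `e`, `p`, `e`.
      ; commute = λ V g k e →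
          let module g = StrongNatTrans g
              natural-ev = g.natural (ev D (T.F₀ X) e)
          in cong (T.μ X) (≈-trans (T.F₀ (T.F₀ X))
               (≈-sym (T.F₀ (T.F₀ X)) (natural-ev _))
               (≈-trans (T.F₀ (T.F₀ X))
                 (cong (g.component (T.F₀ X)) (λ _ → ≈-refl (T.F₀ X)))
                 (natural-ev (to k e))))
      }

    module _ (B : TensorAlgebra T (Reader E)) where
      open TensorAlgebra B

      b-T-hom : IsHomomorphism T.functor (lift-T a) a b
      b-T-hom u = begin
        to b (to (lift-T a) u)
          -- At `e`, the operation `op` takes `ev D A e` to `T.F₁ (ev D A e)` at `u`; applying `a`
          -- gives the `e`-entry of `lift-T a` at `u`.
          ≈⟨ cong b (λ _ → ≈-refl A) ⟩
        to b (to (P₁ (a ∘ StrongNatTrans.component op A)) evs)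
          ≈⟨ commute (D ⇨ A) op evs ⟨
        to a (to (T.F₁ (to (powerAlgebra (D ⇨ A) (PowerStrength D) b) evs)) u)
          -- The power of `b`, applied to the family of evaluations, is the map `b` again.
          ≈⟨ cong a (T.F-cong (λ _ → cong b (λ _ → ≈-refl A)) u) ⟩
        to a (to (T.F₁ b) u) ∎
        where
          open import Relation.Binary.Reasoning.Setoid (setoid A)
          op : PreOperation (D ⇨ A) T.isStrong
          op = yoneda T.isStrong u
          evs : Carrier (D ⇨ ((D ⇨ A) ⇨ A))
          evs = fromDiscrete E ((D ⇨ A) ⇨ A) (ev D A)

      counit : TensorHom T (Reader E) (free A) B
      counit = record
        { map = b ∘ P₁ a
        ; a-hom = λ u → begin
            to b (to (P₁ a) (to (lift-T (T.μ A)) u))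
              -- The multiplication law makes `a` a homomorphism from the free algebra on `A`, hence
              -- `P₁ a` one between the powers.
              ≈⟨ cong b (lift-T-hom (T.μ A) a a (IsEMAlgebra.mult-law a-isEM) u) ⟩
            to b (to (lift-T a) (to (T.F₁ (P₁ a)) u))
              ≈⟨ b-T-hom _ ⟩
            to a (to (T.F₁ b) (to (T.F₁ (P₁ a)) u))
              ≈⟨ cong a (T.homomorphism u) ⟨
            to a (to (T.F₁ (b ∘ P₁ a)) u) ∎
        ; b-hom = λ g → begin
            to b (to (P₁ a) (to (ζ E (T.F₀ A)) g))
              -- Naturality of `ζ` in `a`, which holds pointwise by computation.
              ≈⟨ cong b (λ _ → ≈-refl A) ⟩
            to b (to (ζ E A) (to (P₁ (P₁ a)) g))
              ≈⟨ IsEMAlgebra.mult-law b-isEM _ ⟩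
            to b (to (P₁ b) (to (P₁ (P₁ a)) g))
              ≈⟨ cong b (λ _ → ≈-refl A) ⟩
            to b (to (P₁ (b ∘ P₁ a)) g) ∎
        }
        where open import Relation.Binary.Reasoning.Setoid (setoid A)

    Free : Functor (Met ℓ) (TensorAlgebras T (Reader E))
    Free = record
      { F₀ = free
      ; F₁ = λ {X} {Y} f → record
        { map = P₁ (T.F₁ f)
        ; a-hom = lift-T-hom (T.μ X) (T.μ Y) (T.F₁ f) λ u → ≈-sym (T.F₀ Y) (NatTrans.natural T.mult f u)
        ; b-hom = λ _ _ → ≈-refl (T.F₀ Y) }
      ; F-cong = λ p h e → T.F-cong p (to h e)
      ; identity = λ h e → T.identity (to h e)
      ; homomorphism = λ h e → T.homomorphism (to h e)
      }

    adjunction : Adjunction Free (Forget T (Reader E))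
    adjunction = record
      { unit = record
        { component = compositeUnit E T
        ; natural = NatTrans.natural C.unit }
      ; counit = record
        { component = counit
        ; natural = λ {B} {B′} f φ →
            let module B = TensorAlgebra B
                module B′ = TensorAlgebra B′
                module f = TensorHom f
            in ≈-trans B′.A
                 (cong B′.b {to (P₁ B′.a) (to (P₁ (T.F₁ f.map)) φ)} {to (P₁ f.map) (to (P₁ B.a) φ)}
                   (λ e → ≈-sym B′.A (f.a-hom (to φ e))))
                 (≈-sym B′.A (f.b-hom (to (P₁ B.a) φ))) }
      -- On a free algebra the counit computes to `compositeMult`, so this triangle is a unit law of
      -- the composite monad.
      ; zig = C.μ-identityˡ
      ; zag = λ B x →
          let open TensorAlgebra B
          in ≈-trans A (cong b (λ _ → IsEMAlgebra.unit-law a-isEM x))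
                       (IsEMAlgebra.unit-law b-isEM x)
      }

  Composite-isTensor : IsTensor T (Reader E) (Composite E T)
  Composite-isTensor = record
    { hasLeftAdjoint = record { L = Free ; adjunction = adjunction }
    ; iso = record
      { forward = record
        { component = λ _ → id
        ; natural = λ {_} {Y} _ _ _ → ≈-refl (T.F₀ Y) }
      ; φ⁻¹ = λ _ → id
      ; inverseˡ = λ X _ _ → ≈-refl (T.F₀ X)
      ; inverseʳ = λ X _ _ → ≈-refl (T.F₀ X)
      ; unit-law = λ X _ _ → ≈-refl (T.F₀ X)
      -- The multiplications already agree; only the `C.F₁ id` on the right has to be absorbed.
      ; mult-law = λ X g → cong (compositeMult E T X) {g} {to (C.F₁ id) g}
          (λ e → ≈-sym (T.F₀ (C.F₀ X)) (C.identity {C.F₀ X} g e))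
      } }

theorem6p18 : ∀ {ℓ} (T : StrongMonad ℓ) (E : Set ℓ) (n : ℕ) → E ↔ Fin n →
    IsTensor T (Reader E) (Composite E T)
theorem6p18 T E _ _ = Composite-isTensor T E
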